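{- Let $W=(P,T,F)$ be a safe and sound Workflow net, with $T$ non-empty, initial place $i$ and output place $o$. Let $\mathcal{D}_W$ be the Declare specification over the alphabet $\Sigma=T$ whose constraint set consists of: the constraint $\textsc{AtMostOne}(i^{\rightarrow})$; the constraint $\textsc{End}({}^{\rightarrow}o)$; and, for every place $p\in P$ with ${}^{\rightarrow}p\neq\emptyset$ and $p^{\rightarrow}\neq\emptyset$, the constraint $\textsc{AlternatePrecedence}({}^{\rightarrow}p,\,p^{\rightarrow})$. Then: (i) every run of $W$ satisfies $\mathcal{D}_W$; and (ii) every trace over $T$ that satisfies $\mathcal{D}_W$ is a run of $W$.
   Context: **Nets.** A Petri net is a bipartite graph $(P,T,F)$ with finite disjoint sets $P$ (places) and $T$ (transitions) and flow relation $F\subseteq (P\times T)\cup(T\times P)$. For a place $p$, its preset is ${}^{\rightarrow}p=\{t\in T: (t,p)\in F\}$ and its postset is $p^{\rightarrow}=\{t\in T:(p,t)\in F\}$. A Workflow net is a Petri net in which (1) there is a unique place $i$ (the initial place) with empty preset; (2) there is a unique place $o$ (the output place) with empty postset; (3) every place and every transition lies on a directed path of the graph from $i$ to $o$. **Behavior.** A marking is a function $M:P\to\mathbb{Z}_{\ge 0}$. The initial marking $M_0$ maps $i$ to $1$ and every other place to $0$. A marking $M$ is final if $M(o)>0$. A marking $M$ enables $t\in T$ iff $M(p)>0$ for all places $p$ with $t\in p^{\rightarrow}$. If $t$ is enabled at $M$, it may fire, giving the marking $M'$ with $M'(p)=M(p)-[t\in p^{\rightarrow}]+[t\in{}^{\rightarrow}p]$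 for every $p$, where $[\cdot]$ is $1$ if the condition holds and $0$ otherwise. A firing sequence is a finite (possibly empty) sequence $\langle t_1,\dots,t_n\rangle$ of transitions that can be fired consecutively, one at a time, starting from $M_0$. A marking is reachable if some firing sequence leads from $M_0$ to it. A run is a firing sequence leading from $M_0$ to a final marking. **Safe and sound.** $W$ is safe if $M(p)\le 1$ for every reachable marking $M$ and every place $p$. $W$ is sound if: (option to complete) from every reachable marking, the marking $M_f$ with $M_f(o)=1$ and $M_f(p)=0$ for $p\ne o$ can be reached by firing transitions; (proper completion) every reachable marking $M$ with $M(o)>0$ equals $M_f$; (no dead transitions) every $t\in T$ is enabled by some reachable marking. **$\mathrm{LTL}_f$ with past.** A trace over a finite alphabet $\Sigma$ is a finite sequence $\pi=\langle a_1,\dots,a_n\rangle$ of symbols of $\Sigma$ with $n\ge 1$; exactly one symbol occurs at each instant. Formulae are built from symbols $a\in\Sigma$, Boolean connectives, $\mathbf{X}$ (next), $\mathbf{U}$ (until), $\mathbf{Y}$ (yesterday), $\mathbf{S}$ (since). For $1\le k\le n$: $\pi,k\models a$ iff $a_k=a$; Boolean connectives as usual; $\pi,k\models\mathbf{X}\varphi$ iff $k<n$ and $\pi,k+1\models\varphi$; $\pi,k\models\mathbf{Y}\varphi$ iff $k>1$ and $\pi,k-1\models\varphi$; $\pi,k\models\varphi_1\mathbf{U}\varphi_2$ iff there is $j$ with $k\le j\le n$, $\pi,j\models\varphi_2$ and $\pi,l\models\varphi_1$ for all $k\le l<j$; $\pi,k\models\varphi_1\mathbf{S}\varphi_2$ iff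 there is $j$ with $1\le j\le k$, $\pi,j\models\varphi_2$ and $\pi,l\models\varphi_1$ for all $j<l\le k$. Abbreviations: $\mathbf{F}\varphi=\mathrm{true}\,\mathbf{U}\,\varphi$, $\mathbf{G}\varphi=\neg\mathbf{F}\neg\varphi$. A trace satisfies $\varphi$, written $\pi\models\varphi$, iff $\pi,1\models\varphi$. **Declare constraints.** For a non-empty set $A\subseteq\Sigma$, write $\bigvee A$ for the disjunction of its symbols. For non-empty $A,B\subseteq\Sigma$: - $\textsc{AtMostOne}(A)$ is the formula $\mathbf{G}(\bigvee A\to\neg\mathbf{X}\mathbf{F}\bigvee A)$; - $\textsc{End}(A)$ is the formula $\mathbf{G}\mathbf{F}\bigvee A$; - $\textsc{AlternatePrecedence}(B,A)$ is the formula $\mathbf{G}\big(\bigvee A\to\mathbf{Y}(\neg\bigvee A\;\mathbf{S}\;\bigvee B)\big)$. A Declare specification is given by a finite non-empty alphabet and a finite set of constraints; a trace satisfies the specification iff it satisfies the conjunction of all its constraint formulae. -}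

module Defs where

open import Data.Bool.Base using (Bool; if_then_else_)
open import Data.Fin.Base as Fin using (Fin; zero; toℕ)
open import Data.Fin.Properties using (_≟_)
open import Data.Fin.Subset using (Subset; _∈_; Nonempty; Empty)
open import Data.Fin.Subset.Properties using (_∈?_; nonempty?)
open import Data.List.Base as List using (List; []; _∷_; allFin; filter; foldr; lookup; mapMaybe)
open import Data.List.NonEmpty.Base using (List⁺; toList)
open import Data.Maybe.Base using (Maybe; just; nothing)
open import Data.Nat.Base using (ℕ; suc; _+_; _∸_; _≤_; _>_; NonZero)
open import Data.Product.Base using (_×_; _,_; proj₁; proj₂; ∃-syntax)
open import Data.Sum.Base using (_⊎_; inj₁; inj₂)
open import Data.Unit.Base using (⊤)
open import Data.Empty using (⊥)
open import Data.Vec.Base using (tabulate)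
open import Relation.Binary.Construct.Closure.ReflexiveTransitive using (Star; ε; _◅_)
open import Relation.Binary.PropositionalEquality using (_≡_; _≗_)
open import Relation.Nullary using (¬_; Dec; does; yes; no)

------------------------------------------------------------------------
-- Petri nets and workflow nets

𝟙 : {A : Set} → Dec A → ℕ
𝟙 d = if does d then 1 else 0

record PetriNet : Set where
  field
    #P #T : ℕ

  Place : Set
  Place = Fin #P

  Transition : Set
  Transition = Fin #T

  field
    -- Characteristic function of F ⊆ (P × T) ∪ (T × P).
    flow : (Place × Transition) ⊎ (Transition × Place) → Bool

  preset postset : Place → Subset #T
  preset  p = tabulate λ t → flow (inj₂ (t , p))
  postset p = tabulate λ t → flow (inj₁ (p , t))

  data Node : Set where
    place      : Place → Node
    transition : Transition → Node

  data _⇒_ : Node → Node → Set where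
    consume : ∀ {p t} → t ∈ postset p → place p ⇒ transition t
    produce : ∀ {t p} → t ∈ preset p → transition t ⇒ place p

  -- Existence of a directed path, possibly of length zero.
  _⇒*_ : Node → Node → Set
  _⇒*_ = Star _⇒_

  Marking : Set
  Marking = Place → ℕ

  Enabled : Marking → Transition → Set
  Enabled M t = ∀ p → t ∈ postset p → M p > 0

  -- The truncated subtraction is exact whenever t is enabled at M.
  fire : Marking → Transition → Marking
  fire M t p = (M p ∸ 𝟙 (t ∈? postset p)) + 𝟙 (t ∈? preset p)

  -- Markings are functions, so they are compared pointwise.
  data _[_⟩_ : Marking → List Transition → Marking → Set where
    []  : ∀ {M M′} → M ≗ M′ → M [ [] ⟩ M′
    _∷_ : ∀ {M M′ t ts} → Enabled M t → fire M t [ ts ⟩ M′ → M [ t ∷ ts ⟩ M′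

  -- One token on the given place, none elsewhere.
  singleToken : Place → Marking
  singleToken q p = 𝟙 (p ≟ q)

record WorkflowNet : Set where
  field
    net : PetriNet
  open PetriNet net public
  field
    i o       : Place
    i-source  : Empty (preset i)
    i-unique  : ∀ p → Empty (preset p) → p ≡ i
    o-sink    : Empty (postset o)
    o-unique  : ∀ p → Empty (postset p) → p ≡ o
    connected : ∀ x → (place i ⇒* x) × (x ⇒* place o)

  M₀ M-f : Marking
  M₀  = singleToken i
  M-f = singleToken o

  Final : Marking → Set
  Final M = M o > 0

  Reachable : Marking → Set
  Reachable M = ∃[ ts ] M₀ [ ts ⟩ M

  IsRun : List Transition → Set
  IsRun ts = ∃[ M ] (M₀ [ ts ⟩ M) × Final M

  Safe : Set
  Safe = ∀ M → Reachable M → ∀ p → M p ≤ 1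

  record Sound : Set where
    field
      optionToComplete  : ∀ M → Reachable M → ∃[ ts ] M [ ts ⟩ M-f
      properCompletion  : ∀ M → Reachable M → M o > 0 → M ≗ M-f
      noDeadTransitions : ∀ t → ∃[ M ] Reachable M × Enabled M t

------------------------------------------------------------------------
-- LTLf with past

infix  9 X_ Y_ F_ G_ ¬′_
infixr 8 _U_ _S_
infixr 7 _∧′_
infixr 6 _∨′_
infixr 5 _⇒′_

data Formula (A : Set) : Set where
  atom           : A → Formula A
  true′ false′   : Formula A
  ¬′_            : Formula A → Formula A
  _∧′_ _∨′_ _⇒′_ : Formula A → Formula A → Formula A
  X_ Y_          : Formula A → Formula A
  _U_ _S_        : Formula A → Formula A → Formula A

F_ G_ : ∀ {A} → Formula A → Formula A
F φ = true′ U φ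
G φ = ¬′ (F (¬′ φ))

Trace : Set → Set
Trace A = List⁺ A

-- Instants are counted from 0, so instant k here is instant k + 1 in the
-- usual numbering 1 … n.
Instant : ∀ {A} → Trace A → Set
Instant π = Fin (List.length (toList π))

-- For X and Y, asking for an instant k′ adjacent to k includes the bounds
-- k < n and k > 1. Satisfaction is decidable when equality of symbols is,
-- so for finite alphabets this reading agrees with the classical one.
_at_⊨_ : ∀ {A} (π : Trace A) → Instant π → Formula A → Set
π at k ⊨ atom a   = lookup (toList π) k ≡ a
π at k ⊨ true′    = ⊤
π at k ⊨ false′   = ⊥
π at k ⊨ (¬′ φ)   = ¬ (π at k ⊨ φ)
π at k ⊨ (φ ∧′ ψ) = (π at k ⊨ φ) × (π at k ⊨ ψ)
π at k ⊨ (φ ∨′ ψ) = (π at k ⊨ φ) ⊎ (π at k ⊨ ψ)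
π at k ⊨ (φ ⇒′ ψ) = (π at k ⊨ φ) → (π at k ⊨ ψ)
π at k ⊨ (X φ)    = ∃[ k′ ] (toℕ k′ ≡ suc (toℕ k)) × (π at k′ ⊨ φ)
π at k ⊨ (Y φ)    = ∃[ k′ ] (suc (toℕ k′) ≡ toℕ k) × (π at k′ ⊨ φ)
π at k ⊨ (φ U ψ)  = ∃[ j ] (k Fin.≤ j) × (π at j ⊨ ψ) ×
                          (∀ l → k Fin.≤ l → l Fin.< j → π at l ⊨ φ)
π at k ⊨ (φ S ψ)  = ∃[ j ] (j Fin.≤ k) × (π at j ⊨ ψ) ×
                          (∀ l → j Fin.< l → l Fin.≤ k → π at l ⊨ φ)

_⊨_ : ∀ {A} → Trace A → Formula A → Set
π ⊨ φ = π at zero ⊨ φ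

------------------------------------------------------------------------
-- Declare

⋁ : ∀ {n} → Subset n → Formula (Fin n)
⋁ {n} A = foldr _∨′_ false′ (List.map atom (filter (_∈? A) (allFin n)))

⋀ : ∀ {A} → List (Formula A) → Formula A
⋀ = foldr _∧′_ true′

data Constraint (n : ℕ) : Set where
  AtMostOne End       : (A : Subset n) → Nonempty A → Constraint n
  AlternatePrecedence : (B A : Subset n) → Nonempty B → Nonempty A → Constraint n

⟦_⟧ : ∀ {n} → Constraint n → Formula (Fin n)
⟦ AtMostOne A _ ⟧               = G (⋁ A ⇒′ ¬′ (X (F ⋁ A)))
⟦ End A _ ⟧                     = G (F ⋁ A)
⟦ AlternatePrecedence B A _ _ ⟧ = G (⋁ A ⇒′ Y ((¬′ ⋁ A) S ⋁ B))

-- A specification over the alphabet Fin n.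
record Specification (n : ℕ) : Set where
  field
    .alphabet-nonempty : NonZero n
    constraints        : List (Constraint n)

_⊨ₛ_ : ∀ {n} → Trace (Fin n) → Specification n → Set
π ⊨ₛ D = π ⊨ ⋀ (List.map ⟦_⟧ (Specification.constraints D))

------------------------------------------------------------------------
-- The specification of a workflow net

module _ (W : WorkflowNet) where
  open WorkflowNet W

  postset-i-nonempty : .{{NonZero #T}} → Nonempty (postset i)
  postset-i-nonempty = first (proj₁ (connected (transition someTransition)))
    where
    inhabited : ∀ n → .{{NonZero n}} → Fin n
    inhabited (suc _) = zero

    someTransition : Transition
    someTransition = inhabited #T

    first : ∀ {p t} → place p ⇒* transition t → Nonempty (postset p)
    first (consume t∈p• ◅ _) = _ , t∈p•

  preset-o-nonempty : .{{NonZero #T}} → Nonempty (preset o)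
  preset-o-nonempty = last (proj₂ (connected (transition (proj₁ postset-i-nonempty))))
    where
    last : ∀ {t p} → transition t ⇒* place p → Nonempty (preset p)
    last (produce t∈•p ◅ ε)             = _ , t∈•p
    last (produce _ ◅ (consume _ ◅ ts)) = last ts

  placeConstraint : Place → Maybe (Constraint #T)
  placeConstraint p with nonempty? (preset p) | nonempty? (postset p)
  ... | yes B≢∅ | yes A≢∅ = just (AlternatePrecedence (preset p) (postset p) B≢∅ A≢∅)
  ... | _       | _       = nothing

  𝒟 : .{{NonZero #T}} → Specification #T
  𝒟 {{T≢∅}} = record
    { alphabet-nonempty = T≢∅
    ; constraints = AtMostOne (postset i) postset-i-nonempty
                  ∷ End (preset o) preset-o-nonempty
                  ∷ mapMaybe placeConstraint (allFin #P)
    }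

{-# OPTIONS --safe #-}

-- The number of tokens on a place is determined by the past of the trace.  In
-- a safe net a token on a place p other than i was put there by some producer
-- of p, and no consumer of p has fired since; conversely such a history always
-- leaves a token on p.  Hence AlternatePrecedence(•p, p•) says that every
-- transition finds its token on p, and AtMostOne(i•) says the same for i.
-- End(•o) says that the last transition marks o; a run cannot continue after
-- marking o, because the marking must then be M-f, which enables nothing.
module Submission where

open import Defs
open import Data.Fin.Base as Fin using (Fin; zero; suc; toℕ; fromℕ; fromℕ<; inject₁)
open import Data.Fin.Properties
  using (_≟_; toℕ<n; toℕ≤pred[n]; toℕ-fromℕ; toℕ-fromℕ<; toℕ-inject₁; toℕ-injective)
open import Data.Fin.Subset using (Subset; _∈_; _∉_; Nonempty; Empty)
open import Data.Fin.Subset.Properties using (_∈?_; nonempty?)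
open import Data.List.Base as List using (List; []; _∷_; allFin; filter; foldr; length; lookup; take)
open import Data.List.Membership.Propositional renaming (_∈_ to _∈ₗ_) using ()
open import Data.List.Membership.Propositional.Properties using (∈-allFin; ∈-filter⁺; ∈-filter⁻)
open import Data.List.NonEmpty.Base using (toList; tail; _∷_)
open import Data.List.Relation.Unary.All as All using (All; []; _∷_)
import Data.List.Relation.Unary.All.Properties as All
open import Data.List.Relation.Unary.Any as Any using (here; there)
import Data.List.Relation.Unary.Any.Properties as Any
open import Data.Maybe.Base using (just)
import Data.Maybe.Relation.Unary.All as Maybe
import Data.Maybe.Relation.Unary.Any as MaybeAny
open import Data.Nat.Base using (ℕ; zero; suc; _∸_; _≤_; _<_; z≤n; s≤s; s≤s⁻¹; NonZero;
  _≤′_; ≤′-refl; ≤′-step)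
open import Data.Nat.Properties
  using (≤-refl; ≤-trans; ≤-reflexive; <⇒≤; ≤-antisym; <-irrefl; n≮0; m<n⇒m<1+n;
         m<1+n⇒m<n∨m≡n; m≤m+n; m≤n+m; m∸n≤m; +-identityʳ; ∸-monoˡ-≤; ≤⇒≤′; ≤′⇒≤; _<?_)
open import Data.Product.Base using (_×_; _,_; proj₁; proj₂; ∃-syntax)
open import Data.Sum.Base using (_⊎_; inj₁; inj₂)
open import Data.Unit.Base using (tt)
open import Function.Base using (_∘_; _$_)
open import Relation.Binary.Construct.Closure.ReflexiveTransitive using (ε; _◅_)
open import Relation.Binary.PropositionalEquality
  using (_≡_; _≗_; refl; sym; trans; cong; subst)
open import Relation.Nullary using (¬_; Dec; yes; no; contradiction)
open import Relation.Nullary.Decidable using (decidable-stable)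
open Specification using (constraints)
open WorkflowNet using (#T; Safe; Sound; IsRun)

-- Instants

instant : ∀ {m n} → n < m → ∃[ k ] toℕ {m} k ≡ n
instant n<m = fromℕ< n<m , toℕ-fromℕ< n<m

predecessor : ∀ {m} (k : Fin m) → 0 < toℕ k → ∃[ k′ ] suc (toℕ {m} k′) ≡ toℕ k
predecessor (suc k) _ = inject₁ k , cong suc (toℕ-inject₁ k)

-- Induction upwards from `a`, taken over `≤′` so that `a` is the base case. The step receives an
-- instant rather than a number, so that it can look up the event there.
ascend : ∀ {m a} (P : ℕ → Set) → P a →
         (∀ (k : Fin m) → a ≤ toℕ k → P (toℕ k) → P (suc (toℕ k))) →
         ∀ {n} → a ≤ n → n ≤ m → P n
ascend {m} {a} P base step a≤n = go (≤⇒≤′ a≤n)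
  where
  go : ∀ {n} → a ≤′ n → n ≤ m → P n
  go ≤′-refl         _   = base
  go (≤′-step {n} h) n<m = subst (P ∘ suc) k≡n $
    step k (subst (a ≤_) (sym k≡n) (≤′⇒≤ h)) (subst P (sym k≡n) (go h (<⇒≤ n<m)))
    where
    k   = proj₁ (instant n<m)
    k≡n = proj₂ (instant n<m)

-- Semantics of the constraint templates

module _ {A : Set} (π : Trace A) where

  last : Instant π
  last = fromℕ (length (tail π))

  ⋀⁺ : ∀ {φs} → All (π ⊨_) φs → π ⊨ ⋀ φs
  ⋀⁺ []       = tt
  ⋀⁺ (p ∷ ps) = p , ⋀⁺ ps

  ⋀⁻ : ∀ {φs} → π ⊨ ⋀ φs → All (π ⊨_) φs
  ⋀⁻ {[]}    _        = []
  ⋀⁻ {_ ∷ _} (p , ps) = p ∷ ⋀⁻ ps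

  G⁺ : ∀ φ → (∀ k → π at k ⊨ φ) → π ⊨ (G φ)
  G⁺ φ h (j , _ , ¬φ , _) = ¬φ (h j)

  -- `G` unfolds to two negations, so only a double negation comes out. It is discharged later
  -- wherever the goal is negated or decidable.
  G⁻ : ∀ φ → π ⊨ (G φ) → ∀ k → ¬ ¬ (π at k ⊨ φ)
  G⁻ φ h k ¬φ = h (k , z≤n , ¬φ , λ _ _ _ → tt)

module _ {n : ℕ} (π : Trace (Fin n)) where

  private
    event : Instant π → Fin n
    event = lookup (toList π)

  ⋁⁺ : ∀ {A k} → event k ∈ A → π at k ⊨ ⋁ A
  ⋁⁺ {A} {k} t∈A = go (∈-filter⁺ (_∈? A) (∈-allFin _) t∈A)
    where
    go : ∀ {xs} → event k ∈ₗ xs → π at k ⊨ foldr _∨′_ false′ (List.map atom xs)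
    go (here t≡x)   = inj₁ t≡x
    go (there t∈xs) = inj₂ (go t∈xs)

  ⋁⁻ : ∀ {A k} → π at k ⊨ ⋁ A → event k ∈ A
  ⋁⁻ {A} {k} h = proj₂ (∈-filter⁻ (_∈? A) {xs = allFin n} (go h))
    where
    go : ∀ {xs} → π at k ⊨ foldr _∨′_ false′ (List.map atom xs) → event k ∈ₗ xs
    go {_ ∷ _} (inj₁ t≡x) = here t≡x
    go {_ ∷ _} (inj₂ h)   = there (go h)

  module _ (A : Subset n) where

    atMostOne⁺ : (∀ j k → j Fin.< k → event j ∈ A → event k ∉ A) →
                 π ⊨ (G (⋁ A ⇒′ ¬′ (X (F ⋁ A))))
    atMostOne⁺ h = G⁺ π (⋁ A ⇒′ ¬′ (X (F ⋁ A))) λ j a → λ (j′ , j′≡1+j , k , j′≤k , b , _) →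
      h j k (subst (_≤ toℕ k) j′≡1+j j′≤k) (⋁⁻ a) (⋁⁻ b)

    atMostOne⁻ : π ⊨ (G (⋁ A ⇒′ ¬′ (X (F ⋁ A)))) →
                 ∀ j k → j Fin.< k → event j ∈ A → event k ∉ A
    atMostOne⁻ h j k j<k a b = G⁻ π (⋁ A ⇒′ ¬′ (X (F ⋁ A))) h j λ f →
      -- Instant `j + 1` exists because it is at most `k`.
      let j′ , j′≡1+j = instant (≤-trans (s≤s j<k) (toℕ<n k))
      in f (⋁⁺ a) (j′ , j′≡1+j , k , subst (_≤ toℕ k) (sym j′≡1+j) j<k , ⋁⁺ b , λ _ _ _ → tt)

    end⁺ : event (last π) ∈ A → π ⊨ (G (F ⋁ A))
    end⁺ h = G⁺ π (F ⋁ A) λ k →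
      last π , subst (toℕ k ≤_) (sym (toℕ-fromℕ _)) (toℕ≤pred[n] k) , ⋁⁺ h , λ _ _ _ → tt

    end⁻ : π ⊨ (G (F ⋁ A)) → event (last π) ∈ A
    end⁻ h = decidable-stable (_ ∈? A) λ ∉A → G⁻ π (F ⋁ A) h (last π) λ (j , last≤j , a , _) →
      ∉A (subst (λ k → event k ∈ A)
        (toℕ-injective (≤-antisym (subst (toℕ j ≤_) (sym (toℕ-fromℕ _)) (toℕ≤pred[n] j)) last≤j))
        (⋁⁻ a))

  module _ (B A : Subset n) where

    -- The reading of `Y ((¬′ ⋁ A) S ⋁ B)` at `m`. Since `m` is a number, it may also be the length
    -- of the trace, one past the last instant.
    ProducedBefore : ℕ → Set
    ProducedBefore m = ∃[ j ] (toℕ j < m) × event j ∈ B ×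
                       (∀ l → j Fin.< l → toℕ l < m → event l ∉ A)

    alternatePrecedence⁺ : (∀ k → event k ∈ A → ProducedBefore (toℕ k)) →
                           π ⊨ (G (⋁ A ⇒′ Y ((¬′ ⋁ A) S ⋁ B)))
    alternatePrecedence⁺ h = G⁺ π (⋁ A ⇒′ Y ((¬′ ⋁ A) S ⋁ B)) λ k a →
      let j , j<k , b , ∉A = h k (⋁⁻ a)
          k′ , 1+k′≡k      = predecessor k (≤-trans (s≤s z≤n) j<k)
      in k′ , 1+k′≡k , j , s≤s⁻¹ (subst (toℕ j <_) (sym 1+k′≡k) j<k) , ⋁⁺ b ,
         λ l j<l l≤k′ l∈A → ∉A l j<l (subst (toℕ l <_) 1+k′≡k (s≤s l≤k′)) (⋁⁻ l∈A)

    alternatePrecedence⁻ : π ⊨ (G (⋁ A ⇒′ Y ((¬′ ⋁ A) S ⋁ B))) →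
                           ∀ k → event k ∈ A → ¬ ¬ ProducedBefore (toℕ k)
    alternatePrecedence⁻ h k a ¬p = G⁻ π (⋁ A ⇒′ Y ((¬′ ⋁ A) S ⋁ B)) h k λ f →
      let k′ , 1+k′≡k , j , j≤k′ , b , ∉A = f (⋁⁺ a)
      in ¬p (j , subst (toℕ j <_) 1+k′≡k (s≤s j≤k′) , ⋁⁻ b ,
             λ l j<l l<k l∈A → ∉A l j<l (s≤s⁻¹ (subst (toℕ l <_) (sym 1+k′≡k) l<k)) (⋁⁺ l∈A))

-- Token counts

𝟙-yes : ∀ {A : Set} (d : Dec A) → A → 𝟙 d ≡ 1
𝟙-yes (yes _) _ = refl
𝟙-yes (no ¬a) a = contradiction a ¬a

𝟙-no : ∀ {A : Set} (d : Dec A) → ¬ A → 𝟙 d ≡ 0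
𝟙-no (yes a) ¬a = contradiction a ¬a
𝟙-no (no _)  _  = refl

𝟙-positive : ∀ {A : Set} (d : Dec A) → 0 < 𝟙 d → A
𝟙-positive (yes a) _ = a

module _ (N : PetriNet) where
  open PetriNet N

  module _ (M : Marking) (t : Transition) (p : Place) where

    fire-produced : t ∈ preset p → 0 < fire M t p
    fire-produced t∈•p rewrite 𝟙-yes (t ∈? preset p) t∈•p = m≤n+m 1 _

    fire-kept : t ∉ postset p → 0 < M p → 0 < fire M t p
    fire-kept t∉p• M>0 rewrite 𝟙-no (t ∈? postset p) t∉p• = ≤-trans M>0 (m≤m+n _ _)

    fire-decreasing : t ∉ preset p → fire M t p ≤ M p
    fire-decreasing t∉•p rewrite 𝟙-no (t ∈? preset p) t∉•p | +-identityʳ (M p ∸ 𝟙 (t ∈? postset p)) =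
      m∸n≤m (M p) (𝟙 (t ∈? postset p))

    -- Safety enters here: the token consumed is the only one.
    fire-emptied : t ∈ postset p → t ∉ preset p → M p ≤ 1 → fire M t p ≤ 0
    fire-emptied t∈p• t∉•p M≤1
      rewrite 𝟙-yes (t ∈? postset p) t∈p• | 𝟙-no (t ∈? preset p) t∉•p | +-identityʳ (M p ∸ 1) =
      ∸-monoˡ-≤ 1 M≤1

    -- If `t` does not produce on `p`, the token was there before; had `t` consumed from `p`,
    -- `fire-emptied` would leave nothing.
    fire-origin : M p ≤ 1 → 0 < fire M t p → t ∈ preset p ⊎ (t ∉ postset p × 0 < M p)
    fire-origin M≤1 fire>0 = go (t ∈? preset p)
      where
      go : Dec (t ∈ preset p) → t ∈ preset p ⊎ (t ∉ postset p × 0 < M p)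
      go (yes t∈•p) = inj₁ t∈•p
      go (no  t∉•p) = inj₂
        ( (λ t∈p• → n≮0 (≤-trans fire>0 (fire-emptied t∈p• t∉•p M≤1)))
        , ≤-trans fire>0 (fire-decreasing t∉•p))

  -- Fires the first `n` transitions without checking enabledness, so that it makes sense for a
  -- trace not yet known to be fireable. Beyond the end of the list the marking stays constant.
  after : Marking → List Transition → ℕ → Marking
  after M _        zero    = M
  after M []       (suc _) = M
  after M (t ∷ ts) (suc n) = after (fire M t) ts n

  after-suc : ∀ M ts (k : Fin (length ts)) →
              after M ts (suc (toℕ k)) ≡ fire (after M ts (toℕ k)) (lookup ts k)
  after-suc M (t ∷ ts) zero    = refl
  after-suc M (t ∷ ts) (suc k) = after-suc (fire M t) ts k

  fireable⇒fires : ∀ {M} ts → (∀ k → Enabled (after M ts (toℕ k)) (lookup ts k)) →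
                   M [ ts ⟩ after M ts (length ts)
  fireable⇒fires []       _ = [] λ _ → refl
  fireable⇒fires (t ∷ ts) h = h zero ∷ fireable⇒fires ts (h ∘ suc)

  fires⇒enabled : ∀ {M M′} ts → M [ ts ⟩ M′ → ∀ k → Enabled (after M ts (toℕ k)) (lookup ts k)
  fires⇒enabled (t ∷ ts) (e ∷ _)  zero    = e
  fires⇒enabled (t ∷ ts) (_ ∷ fs) (suc k) = fires⇒enabled ts fs k

  fires⇒after : ∀ {M M′ ts} → M [ ts ⟩ M′ → after M ts (length ts) ≗ M′
  fires⇒after ([] M≗M′) = M≗M′
  fires⇒after (_ ∷ fs)  = fires⇒after fs

  -- Makes all intermediate markings of a run reachable, so that safety and proper completion apply
  -- to them.
  fires-take : ∀ {M M′ ts} → M [ ts ⟩ M′ → ∀ n → M [ take n ts ⟩ after M ts n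
  fires-take fs       zero    = [] λ _ → refl
  fires-take ([] _)   (suc _) = [] λ _ → refl
  fires-take (e ∷ fs) (suc n) = e ∷ fires-take fs n

  -- Token history of a single place

  module _ (M : Marking) (π : Trace Transition) (p : Place) where
    private
      ts    = toList π
      event = lookup ts
      marking = after M ts

    token-kept : ∀ {a n} → 0 < marking a p → (∀ l → a ≤ toℕ l → toℕ l < n → event l ∉ postset p) →
                 a ≤ n → n ≤ length ts → 0 < marking n p
    token-kept {a} M>0 unused a≤n n≤len =
      ascend (λ m → (∀ l → a ≤ toℕ l → toℕ l < m → event l ∉ postset p) → 0 < marking m p)
        (λ _ → M>0)
        (λ k a≤k ih unused → subst (λ M → 0 < M p) (sym (after-suc M ts k))
          (fire-kept (marking (toℕ k)) (event k) p (unused k a≤k ≤-refl)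
            (ih λ l a≤l l<k → unused l a≤l (m<n⇒m<1+n l<k))))
        a≤n n≤len unused

    producedBefore⇒token : ∀ {n} → n ≤ length ts → ProducedBefore π (preset p) (postset p) n →
                           0 < marking n p
    producedBefore⇒token n≤len (j , j<n , j∈•p , unused) =
      token-kept (subst (λ M → 0 < M p) (sym (after-suc M ts j))
          (fire-produced (marking (toℕ j)) (event j) p j∈•p))
        unused j<n n≤len

    token⇒producedBefore : ¬ 0 < M p → (∀ n → marking n p ≤ 1) →
                           ∀ {n} → n ≤ length ts → 0 < marking n p →
                           ProducedBefore π (preset p) (postset p) n
    token⇒producedBefore M≯0 safe = ascend
      (λ n → 0 < marking n p → ProducedBefore π (preset p) (postset p) n)
      (λ M>0 → contradiction M>0 M≯0)
      step z≤n
      where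
      step : ∀ k → 0 ≤ toℕ k →
             (0 < marking (toℕ k) p → ProducedBefore π (preset p) (postset p) (toℕ k)) →
             0 < marking (suc (toℕ k)) p → ProducedBefore π (preset p) (postset p) (suc (toℕ k))
      step k _ ih >0
        with fire-origin (marking (toℕ k)) (event k) p (safe (toℕ k)) (subst (λ M → 0 < M p) (after-suc M ts k) >0)
      -- The event itself is the latest producer; no instant lies strictly between `k` and `k + 1`.
      ... | inj₁ k∈•p = k , ≤-refl , k∈•p , λ l k<l l≤k → contradiction (≤-trans l≤k k<l) (<-irrefl refl)
      ... | inj₂ (k∉p• , M>0) =
        let j , j<k , j∈•p , unused = ih M>0
        -- The earlier producer still serves; the only new instant to check is `k`, which does not
        -- consume.
        in j , m<n⇒m<1+n j<k , j∈•p , λ l j<l l≤k → case-last unused l j<l (m<1+n⇒m<n∨m≡n l≤k)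
        where
        case-last : ∀ {j} → (∀ l → toℕ j < toℕ l → toℕ l < toℕ k → event l ∉ postset p) →
                    ∀ l → toℕ {length ts} j < toℕ l → toℕ l < toℕ k ⊎ toℕ l ≡ toℕ k → event l ∉ postset p
        case-last unused l j<l (inj₁ l<k) = unused l j<l l<k
        case-last unused l j<l (inj₂ l≡k) rewrite toℕ-injective l≡k = k∉p•

    -- By safety the first consumption empties `p`, and nothing refills it, so a later consumer
    -- would not be enabled.
    source-consumed-once : Empty (preset p) → (∀ n → marking n p ≤ 1) →
                           (∀ k → Enabled (marking (toℕ k)) (event k)) →
                           ∀ j k → j Fin.< k → event j ∈ postset p → event k ∉ postset p
    source-consumed-once •p≡∅ safe enabled j k j<k j∈p• k∈p• =
      n≮0 (≤-trans (enabled k p k∈p•) (ascend {length ts} (λ n → marking n p ≤ 0)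
        (subst (λ M → M p ≤ 0) (sym (after-suc M ts j))
          (fire-emptied (marking (toℕ j)) (event j) p j∈p• (λ t∈ → •p≡∅ (_ , t∈)) (safe (toℕ j))))
        (λ l _ ih → subst (λ M → M p ≤ 0) (sym (after-suc M ts l))
          (≤-trans (fire-decreasing (marking (toℕ l)) (event l) p λ t∈ → •p≡∅ (_ , t∈)) ih))
        j<k (<⇒≤ (toℕ<n k))))

-- Workflow nets

module _ (W : WorkflowNet) where
  open WorkflowNet W hiding (#T; Safe; Sound; IsRun)

  input-place : ∀ t → ∃[ p ] t ∈ postset p
  input-place t = go (proj₁ (connected (transition t)))
    where
    go : ∀ {p} → place p ⇒* transition t → ∃[ q ] t ∈ postset q
    go (consume t∈p• ◅ ε)                = _ , t∈p•
    go (consume _ ◅ (produce _ ◅ path)) = go path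

  -- Every transition has an input place; at `M-f` that place could only be `o`, which has no
  -- consumers.
  M-f-disabled : ∀ {M t} → M ≗ M-f → ¬ Enabled M t
  M-f-disabled {t = t} M≗M-f enabled =
    let p , t∈p• = input-place t
        p≡o      = 𝟙-positive (p ≟ o) (subst (0 <_) (M≗M-f p) (enabled p t∈p•))
    in o-sink (t , subst (λ q → t ∈ postset q) p≡o t∈p•)

  -- The nonemptiness proofs are existential because the constraint carries those returned by
  -- `nonempty?`.
  placeConstraint-just : ∀ {p} → Nonempty (preset p) → Nonempty (postset p) →
    ∃[ B≢∅ ] ∃[ A≢∅ ] placeConstraint W p ≡ just (AlternatePrecedence (preset p) (postset p) B≢∅ A≢∅)
  placeConstraint-just {p} B≢∅ A≢∅ with nonempty? (preset p) | nonempty? (postset p)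
  ... | yes B≢∅′ | yes A≢∅′ = B≢∅′ , A≢∅′ , refl
  ... | no  B≡∅  | _        = contradiction B≢∅ B≡∅
  ... | yes _    | no  A≡∅  = contradiction A≢∅ A≡∅

  module _ .{{_ : NonZero (#T W)}} where

    -- With a transition present, `o` has a producer, while `i` has none.
    i≢o : ¬ i ≡ o
    i≢o i≡o = i-source (subst (Nonempty ∘ preset) (sym i≡o) (preset-o-nonempty W))

    module _ (π : Trace Transition) where
      private
        event = lookup (toList π)

      𝒟⁺ : (∀ j k → j Fin.< k → event j ∈ postset i → event k ∉ postset i) →
           event (last π) ∈ preset o →
           (∀ p → Nonempty (preset p) → ∀ k → event k ∈ postset p →
              ProducedBefore π (preset p) (postset p) (toℕ k)) →
           π ⊨ₛ 𝒟 W
      𝒟⁺ once ends produced = ⋀⁺ π $ All.map⁺ {xs = constraints (𝒟 W)} $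
        atMostOne⁺ π _ once ∷ end⁺ π _ ends ∷
        All.mapMaybe⁺ (All.map⁺ (All.universal constraint (allFin _)))
        where
        constraint : ∀ p → Maybe.All (λ c → π ⊨ ⟦ c ⟧) (placeConstraint W p)
        constraint p with nonempty? (preset p) | nonempty? (postset p)
        ... | yes B≢∅ | yes _ = Maybe.just (alternatePrecedence⁺ π _ _ (produced p B≢∅))
        ... | yes _   | no  _ = Maybe.nothing
        ... | no  _   | _     = Maybe.nothing

      𝒟⁻ : π ⊨ₛ 𝒟 W →
           (∀ j k → j Fin.< k → event j ∈ postset i → event k ∉ postset i) ×
           event (last π) ∈ preset o ×
           (∀ p → Nonempty (preset p) → ∀ k → event k ∈ postset p →
              ¬ ¬ ProducedBefore π (preset p) (postset p) (toℕ k))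
      𝒟⁻ sat with once ∷ ends ∷ places ← All.map⁻ {xs = constraints (𝒟 W)} {f = ⟦_⟧} (⋀⁻ π sat) =
        atMostOne⁻ π _ once , end⁻ π _ ends , λ p B≢∅ k k∈p• →
          -- The consuming event at `k` itself witnesses that the postset of `p` is nonempty.
          let B≢∅ , A≢∅ , eq = placeConstraint-just B≢∅ (_ , k∈p•)
              c∈             = Any.mapMaybe⁺ (placeConstraint W) (allFin _) $ Any.map⁺ $
                Any.map (λ { refl → subst (MaybeAny.Any (_ ≡_)) (sym eq) (MaybeAny.just refl) })
                  (∈-allFin p)
          in alternatePrecedence⁻ π _ _ (All.lookup places c∈) k k∈p•

    -- From runs to satisfying traces and back

    run⇒satisfies : Safe W → Sound W → ∀ π → IsRun W (toList π) → π ⊨ₛ 𝒟 W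
    run⇒satisfies safe sound π (M , fires , final) = 𝒟⁺ π
      (source-consumed-once net M₀ π i i-source (tokens≤1 i) enabled)
      (decidable-stable (_ ∈? preset o) last∉•o⇒⊥)
      (λ p B≢∅ k k∈p• → token⇒producedBefore net M₀ π p
        -- A place with a producer is not `i`, so it starts empty.
        (λ >0 → i-source (subst (Nonempty ∘ preset) (𝟙-positive (p ≟ i) >0) B≢∅))
        (tokens≤1 p) (<⇒≤ (toℕ<n k)) (enabled k p k∈p•))
      where
      ts      = toList π
      end     = last π
      marking = after net M₀ ts

      reachable : ∀ n → Reachable (marking n)
      reachable n = take n ts , fires-take net fires n

      tokens≤1 : ∀ p n → marking n p ≤ 1
      tokens≤1 p n = safe _ (reachable n) p

      enabled : ∀ k → Enabled (marking (toℕ k)) (lookup ts k)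
      enabled = fires⇒enabled net ts fires

      fired-end : fire (marking (toℕ end)) (lookup ts end) o ≡ M o
      fired-end = trans (cong (_$ o) (sym (after-suc net M₀ ts end)))
        (trans (cong (λ n → marking (suc n) o) (toℕ-fromℕ (length (tail π))))
          (fires⇒after net fires o))

      -- Otherwise `o` is marked already before the last event, so proper completion gives `M-f`
      -- there, although that event is enabled.
      last∉•o⇒⊥ : ¬ lookup ts end ∉ preset o
      last∉•o⇒⊥ end∉•o = M-f-disabled
        (Sound.properCompletion sound (marking (toℕ end)) (reachable (toℕ end))
          (≤-trans (subst (0 <_) (sym fired-end) final)
            (fire-decreasing net (marking (toℕ end)) (lookup ts end) o end∉•o)))
        (enabled end)

    satisfies⇒run : ∀ π → π ⊨ₛ 𝒟 W → IsRun W (toList π)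
    satisfies⇒run π sat with once , ends , produced ← 𝒟⁻ π sat =
      marking (length ts) , fireable⇒fires net ts enabled , final
      where
      ts      = toList π
      end     = last π
      marking = after net M₀ ts

      enabled : ∀ k → Enabled (marking (toℕ k)) (lookup ts k)
      enabled k p k∈p• with nonempty? (preset p)
      -- Positivity of a count is decidable, which removes the double negation left by `𝒟⁻`.
      ... | yes B≢∅ = decidable-stable (0 <? marking (toℕ k) p) λ ≯0 → produced p B≢∅ k k∈p•
        (≯0 ∘ producedBefore⇒token net M₀ π p (<⇒≤ (toℕ<n k)))
      -- Without producers `p` is `i`. Its initial token is still there, since an earlier consumer
      -- would be a second one besides `k`.
      ... | no  B≡∅ with refl ← i-unique p B≡∅ = token-kept net M₀ π i {a = 0}
        (≤-reflexive (sym (𝟙-yes (i ≟ i) refl)))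
        (λ l _ l<k l∈i• → once l k l<k l∈i• k∈p•) z≤n (<⇒≤ (toℕ<n k))

      final : Final (marking (length ts))
      final = subst (λ n → 0 < marking (suc n) o) (toℕ-fromℕ (length (tail π)))
        (subst (λ M → 0 < M o) (sym (after-suc net M₀ ts end))
          (fire-produced net (marking (toℕ end)) (lookup ts end) o ends))

theorem1 : (W : WorkflowNet) .{{_ : NonZero (#T W)}} → Safe W → Sound W →
    (∀ ts → IsRun W ts → ∃[ π ] (toList π ≡ ts) × (π ⊨ₛ 𝒟 W)) ×
    (∀ π → π ⊨ₛ 𝒟 W → IsRun W (toList π))
theorem1 W safe sound = run , satisfies⇒run W
  where
  open WorkflowNet W using (net; o)

  run : ∀ ts → IsRun W ts → ∃[ π ] (toList π ≡ ts) × (π ⊨ₛ 𝒟 W)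
  -- The empty sequence ends in `M₀`, which marks only `i`; being final would force `i ≡ o`. Hence
  -- every run is a trace.
  run []       (_ , fires , final) = contradiction
    (sym (𝟙-positive (o ≟ _) (subst (0 <_) (sym (fires⇒after net fires o)) final)))
    (i≢o W)
  run (t ∷ ts) isRun = (t ∷ ts) , refl , run⇒satisfies W safe sound (t ∷ ts) isRun
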